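{- Let $n, k \geq 0$ and $r \geq 2$ be integers. If $\mathcal{F}$ is a locally $k$-wide family of subsets of an $n$-element set $X$, then the number of members of $\mathcal{F}$ with exactly $r$ elements is at most $\frac{nk}{r}$.
   Context: A family $\mathcal{F}$ of subsets of a finite set $X$ is locally $k$-wide iff for every $x \in X$ every antichain (with respect to inclusion) of $\{U \in \mathcal{F} \mid x \in U\}$ has at most $k$ members. -}

module Defs where

open import Data.Fin.Base using (Fin)
open import Data.Fin.Subset using (Subset; _⊆_; ∣_∣)
open import Data.Fin.Subset.Properties using (_∈?_)
open import Data.List.Base using (List; length; filter)
open import Data.List.Membership.Propositional using (_∈_)
open import Data.List.Relation.Unary.Unique.Propositional using (Unique)
open import Data.List.Relation.Unary.Unique.Propositional.Properties using (filter⁺)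
open import Data.Nat.Base using (ℕ; _≤_)
open import Data.Nat.Properties using (_≟_)
open import Relation.Binary.PropositionalEquality using (_≡_)
open import Relation.Unary using (Pred; Decidable)

-- A (finite) set of subsets of Fin n, listed without repetition; the order of
-- the list is irrelevant to everything below.
record Family (n : ℕ) : Set where
  constructor family
  field
    members  : List (Subset n)
    distinct : Unique members

open Family public

private
  variable
    n : ℕ

infix 4 _∈ᶠ_ _⊆ᶠ_

_∈ᶠ_ : Subset n → Family n → Set
U ∈ᶠ F = U ∈ members F

_⊆ᶠ_ : Family n → Family n → Set
F ⊆ᶠ G = ∀ {U} → U ∈ᶠ F → U ∈ᶠ G

size : Family n → ℕ
size F = length (members F)

select : ∀ {p} {P : Pred (Subset n) p} → Decidable P → Family n → Family n
select P? F = family (filter P? (members F)) (filter⁺ P? (distinct F))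

containing : Fin n → Family n → Family n
containing x = select (x ∈?_)

withCardinality : ℕ → Family n → Family n
withCardinality r = select (λ U → ∣ U ∣ ≟ r)

Antichain : Family n → Set
Antichain A = ∀ {U V} → U ∈ᶠ A → V ∈ᶠ A → U ⊆ V → U ≡ V

LocallyWide : ℕ → Family n → Set
LocallyWide {n} k F =
  ∀ (x : Fin n) (A : Family n) → A ⊆ᶠ containing x F → Antichain A → size A ≤ k

{-# OPTIONS --safe #-}

-- Double counting of the incidences x ∈ U with ∣ U ∣ = r: each such U contributes
-- r of them, while each of the n points x contributes at most k, since the
-- members of size r containing x form an antichain.
module Submission where

open import Algebra.Properties.CommutativeSemigroup using (x∙yz≈y∙xz)
open import Data.Bool.Base using (true; false)
open import Data.Fin.Base using (Fin; zero; suc)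
open import Data.Fin.Subset using (Subset; inside; outside; _⊆_; ∣_∣)
open import Data.Fin.Subset.Properties using (_∈?_; drop-∷-⊆; p⊆q⇒∣p∣≤∣q∣)
open import Data.Integer.Base using (+_)
import Data.Integer.Base as ℤ
import Data.Integer.Properties as ℤ
open import Data.List.Base using (List; []; _∷_; length; map; filter)
open import Data.List.Membership.Propositional.Properties using (∈-filter⁺; ∈-filter⁻)
open import Data.List.Relation.Unary.All using (All; []; _∷_)
open import Data.List.Relation.Unary.All.Properties using (all-filter)
open import Data.Nat.Base using (ℕ; suc; _+_; _*_; _≥_; z≤n; s≤s; >-nonZero; NonZero)
import Data.Nat.Base as ℕ
open import Data.Nat.ListAction using (sum)
open import Data.Nat.Properties using (≤-trans; _≟_; suc-injective; 1+n≰n; +-mono-≤; +-commutativeSemigroup)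
open import Data.Product.Base using (_,_; proj₁)
open import Data.Rational.Base using (_≤_; _/_)
open import Data.Rational.Properties using (toℚᵘ-cancel-≤; toℚᵘ-fromℚᵘ)
open import Data.Rational.Unnormalised.Base using (mkℚᵘ; *≤*)
import Data.Rational.Unnormalised.Properties as ℚᵘ
open import Data.Vec.Base using ([]; _∷_; tail; here)
open import Relation.Binary.PropositionalEquality using (_≡_; refl; sym; trans; cong; subst; subst₂)
open import Relation.Nullary.Decidable.Core using (does)
open import Relation.Nullary.Negation.Core using (contradiction)
open import Defs

private
  variable
    n : ℕ

-- Stated for lists rather than families because deleting a point with `map tail` can make distinct
-- subsets coincide, and the count must keep multiplicities.
degree : Fin n → List (Subset n) → ℕ
degree x Us = length (filter (x ∈?_) Us)

degree-suc : (x : Fin n) (Us : List (Subset (suc n))) →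
  degree (suc x) Us ≡ degree x (map tail Us)
degree-suc x []             = refl
degree-suc x ((_ ∷ U) ∷ Us) with does (x ∈? U)
... | true  = cong suc (degree-suc x Us)
... | false = degree-suc x Us

sum-∣∣-suc : (Us : List (Subset (suc n))) →
  sum (map ∣_∣ Us) ≡ degree zero Us + sum (map ∣_∣ (map tail Us))
sum-∣∣-suc []                   = refl
sum-∣∣-suc ((b ∷ U) ∷ Us)
  -- Both values of `b` rest on this equation: `outside` needs exactly it, while `inside` adds one
  -- to the cardinality on the left and to the degree of `zero` on the right.
  with eq ← trans (cong (λ m → ∣ U ∣ + m) (sum-∣∣-suc Us))
                  (x∙yz≈y∙xz +-commutativeSemigroup ∣ U ∣ (degree zero Us) _)
  with b
... | inside  = cong suc eq
... | outside = eq

-- Induction on the ground set: removing the point `zero` costs its degree, at most `k`, and leaves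
-- the degrees of the other points unchanged.
degree≤⇒sum-∣∣≤ : ∀ n k (Us : List (Subset n)) → (∀ x → degree x Us ℕ.≤ k) →
  sum (map ∣_∣ Us) ℕ.≤ n * k
degree≤⇒sum-∣∣≤ ℕ.zero  k []        deg≤k = z≤n
degree≤⇒sum-∣∣≤ ℕ.zero  k ([] ∷ Us) deg≤k = degree≤⇒sum-∣∣≤ 0 k Us λ ()
degree≤⇒sum-∣∣≤ (suc n) k Us        deg≤k rewrite sum-∣∣-suc Us =
  +-mono-≤ (deg≤k zero) (degree≤⇒sum-∣∣≤ n k (map tail Us) λ x →
    subst (ℕ._≤ k) (degree-suc x Us) (deg≤k (suc x)))

sum-map-const : ∀ {a} {A : Set a} {f : A → ℕ} {r xs} →
  All (λ x → f x ≡ r) xs → sum (map f xs) ≡ length xs * r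
sum-map-const []            = refl
sum-map-const (refl ∷ fxs≡) = cong (λ m → _ + m) (sum-map-const fxs≡)

⊆∧∣∣≡⇒≡ : {U V : Subset n} → U ⊆ V → ∣ U ∣ ≡ ∣ V ∣ → U ≡ V
⊆∧∣∣≡⇒≡ {U = []}          {[]}          U⊆V eq = refl
⊆∧∣∣≡⇒≡ {U = inside ∷ U}  {inside ∷ V}  U⊆V eq =
  cong (inside ∷_) (⊆∧∣∣≡⇒≡ (drop-∷-⊆ U⊆V) (suc-injective eq))
⊆∧∣∣≡⇒≡ {U = inside ∷ U}  {outside ∷ V} U⊆V eq = contradiction (U⊆V here) λ ()
-- Here `eq` says that `U` has one element more than `V`, although the tails still satisfy `U ⊆ V`.
⊆∧∣∣≡⇒≡ {U = outside ∷ U} {inside ∷ V}  U⊆V eq =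
  contradiction (subst (ℕ._≤ ∣ V ∣) eq (p⊆q⇒∣p∣≤∣q∣ (drop-∷-⊆ U⊆V))) 1+n≰n
⊆∧∣∣≡⇒≡ {U = outside ∷ U} {outside ∷ V} U⊆V eq =
  cong (outside ∷_) (⊆∧∣∣≡⇒≡ (drop-∷-⊆ U⊆V) eq)

locallyWide⇒degree≤ : ∀ {k} r (F : Family n) → LocallyWide k F →
  ∀ x → degree x (members (withCardinality r F)) ℕ.≤ k
-- The degree of `x` unfolds to `size A`, so the bound from `wide` is literally the goal.
locallyWide⇒degree≤ {n} r F wide x = wide x A A⊆ antichain
  where
  r? = λ (U : Subset n) → ∣ U ∣ ≟ r
  Fᵣ = members (withCardinality r F)

  A : Family n
  A = containing x (withCardinality r F)

  A⊆ : A ⊆ᶠ containing x F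
  A⊆ U∈A with U∈Fᵣ , x∈U ← ∈-filter⁻ (x ∈?_) {xs = Fᵣ} U∈A =
    ∈-filter⁺ (x ∈?_) (proj₁ (∈-filter⁻ r? {xs = members F} U∈Fᵣ)) x∈U

  card : ∀ {U} → U ∈ᶠ A → ∣ U ∣ ≡ r
  card U∈A with U∈Fᵣ , _  ← ∈-filter⁻ (x ∈?_) {xs = Fᵣ} U∈A
           with _ , ∣U∣≡r ← ∈-filter⁻ r? {xs = members F} U∈Fᵣ = ∣U∣≡r

  antichain : Antichain A
  antichain U∈A V∈A U⊆V = ⊆∧∣∣≡⇒≡ U⊆V (trans (card U∈A) (sym (card V∈A)))

-- Since `_/_` reduces to lowest terms, the cross-multiplication takes place in the unnormalised
-- rationals.
*≤⇒≤/ : ∀ a b r .{{_ : NonZero r}} → a * r ℕ.≤ b → (+ a) / 1 ≤ (+ b) / r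
*≤⇒≤/ a b (suc r) a*r≤b = toℚᵘ-cancel-≤ (begin
  _                ≃⟨ toℚᵘ-fromℚᵘ (mkℚᵘ (+ a) 0) ⟩
  -- `mkℚᵘ` takes the denominator minus one, so `0` and `r` stand for the denominators 1 and
  -- `suc r`.
  mkℚᵘ (+ a) 0     ≤⟨ *≤* (subst₂ ℤ._≤_ (ℤ.pos-* a (suc r)) (sym (ℤ.*-identityʳ (+ b))) (ℤ.+≤+ a*r≤b)) ⟩
  mkℚᵘ (+ b) r     ≃⟨ toℚᵘ-fromℚᵘ (mkℚᵘ (+ b) r) ⟨
  _                ∎)
  where open ℚᵘ.≤-Reasoning

theorem3p3p5 : (n k r : ℕ) (r≥2 : r ≥ 2) (F : Family n) → LocallyWide k F →
    (+ size (withCardinality r F)) / 1 ≤ _/_ (+ (n * k)) r {{>-nonZero (≤-trans (s≤s z≤n) r≥2)}}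
theorem3p3p5 n k r r≥2 F wide =
  *≤⇒≤/ (size (withCardinality r F)) (n * k) r {{>-nonZero (≤-trans (s≤s z≤n) r≥2)}}
    -- Every selected member has cardinality `r`, which turns the sum of cardinalities into the
    -- number of members times `r`.
    (subst (ℕ._≤ n * k)
      (sum-map-const (all-filter (λ U → ∣ U ∣ ≟ r) (members F)))
      (degree≤⇒sum-∣∣≤ n k (members (withCardinality r F)) (locallyWide⇒degree≤ r F wide)))
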